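{- Let $I=\{1,\dots,n\}$ be a finite set of agents, $\Phi$ a set of primitive propositions, and $\Theta$ a countable dense subset of $[0,1]$. Let $\mathcal{M}=((\Omega,(\mathit{Pr}_i)_{i\in I}),\pi)$ be a probability model over $(\Phi,I)$, and let $\mathcal{T}_{\mathcal M}=(X,(T_i)_{i\in I},(\beta_i)_{i\in I})$ be the structure built from $\mathcal M$ using the language $\mathcal{L}_B^\Theta(\Phi,I)$ as described in the context. Then $\mathcal{T}_{\mathcal M}$ is a type space. Define $\nu(p)=E_0(p)$ for $p\in\Phi$. Then $\mathcal{I}_{\mathcal M}=(\mathcal{T}_{\mathcal M},\nu)$ is an interpreted type space, and for all $\phi\in\mathcal{L}_B^\Theta(\Phi,I)$ and all $\omega\in\Omega$, $$\omega\in[\![\phi]\!]_{\mathcal M}\ \Rightarrow\ (d_0(\omega),d(\omega))\in[\![\phi]\!]_{\mathcal{I}_{\mathcal M}},$$ where $d(\omega)=(d_1(\omega),\dots,d_n(\omega))$.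
   Context: **Measure theory.** A measurable space is a set $Y$ with a $\sigma$-algebra $\Sigma_Y$. $\Delta(Y)$ is the set of probability measures on $Y$ with the $\sigma$-algebra generated by the sets $\mathcal{B}^\theta(E)=\{\mu\in\Delta(Y):\mu(E)\ge\theta\}$, $\theta\in[0,1]$, $E\in\Sigma_Y$. Finite products carry the product $\sigma$-algebra. For $\mu\in\Delta(Y)$ and $A\subseteq Y$, $\mu^*(A)=\inf\{\mu(E):E\in\Sigma_Y,\ E\supseteq A\}$. Write $T=\prod_{i\in I}T_i$. **Type spaces.** A type space (over $I$) is $\mathcal{T}=(X,(T_i)_{i\in I},(\beta_i)_{i\in I})$ where $X$ and each $T_i$ are measurable spaces and each $\beta_i:T_i\to\Delta(X\times T)$ is a measurable function such that the marginal of $\beta_i(t_i)$ on $T_i$ is $\delta_{t_i}$ (for events $E\subseteq T_i$, $\delta_{t_i}(E)=1$ if $t_i\in E$ and $0$ otherwise). **Language.** $\mathcal{L}_B^\Theta(\Phi,I)$ is generated by $\phi::=p\mid\lnot\phi\mid\phi\land\psi\mid B_i^\theta\phi$ with $p\in\Phi$, $i\in I$, $\theta\in\Theta$. **Interpreted type spaces.** An interpreted type space over $(\Phi,I)$ is $\mathcal I=(\mathcal T,\nu)$ with $\mathcal T$ a type space and $\nu:\Phi\to\Sigma_X$ any map. Truth sets: $[\![p]\!]_{\mathcal I}=\nu(p)\times T$, $[\![\lnot\phi]\!]_{\mathcal I}=(X\times T)\setminus[\![\phi]\!]_{\mathcal I}$, $[\![\phi\land\psi]\!]_{\mathcal I}=[\![\phi]\!]_{\mathcal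 I}\cap[\![\psi]\!]_{\mathcal I}$, $[\![B_i^\theta\phi]\!]_{\mathcal I}=\{(x,t)\in X\times T:\beta_i(t_i)([\![\phi]\!]_{\mathcal I})\ge\theta\}$. **Probability models.** A probability frame (over $I$) is $(\Omega,(\mathit{Pr}_i)_{i\in I})$ where $\Omega$ is a measurable space and each $\mathit{Pr}_i:\Omega\to\Delta(\Omega)$ is measurable with $\mathit{Pr}_i(\omega)^*(\mathit{Pr}_i^{ -1}(\mathit{Pr}_i(\omega)))=1$ for all $\omega$. A probability model over $(\Phi,I)$ is a probability frame together with a map $\pi:\Phi\to\Sigma_\Omega$. Truth sets: $[\![p]\!]_{\mathcal M}=\pi(p)$, $[\![\lnot\phi]\!]_{\mathcal M}=\Omega\setminus[\![\phi]\!]_{\mathcal M}$, $[\![\phi\land\psi]\!]_{\mathcal M}=[\![\phi]\!]_{\mathcal M}\cap[\![\psi]\!]_{\mathcal M}$, $[\![B_i^\theta\phi]\!]_{\mathcal M}=\{\omega:\mathit{Pr}_i(\omega)([\![\phi]\!]_{\mathcal M})\ge\theta\}$. A set of formulas is satisfiable if all its members are true at one common world of some probability model. **Construction of $\mathcal{T}_{\mathcal M}$.** Let $\mathcal L=\mathcal{L}_B^\Theta(\Phi,I)$. A description is a satisfiable set $D\subseteq\mathcal L$ such that for each $\phi\in\mathcal L$, $\phi\in D$ or $\lnot\phi\in D$. For $\omega\in\Omega$ let $D(\omega)=\{\phi\in\mathcal L:\omega\in[\![\phi]\!]_{\mathcal M}\}$; let $d_0(\omega)\subseteq D(\omega)$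 consist of its purely propositional formulas (Boolean combinations of primitive propositions), and $d_i(\omega)\subseteq D(\omega)$ of its formulas that are Boolean combinations of formulas of the form $B_i^\theta\phi$. Set $X=\{d_0(\omega):\omega\in\Omega\}$ with the $\sigma$-algebra generated by the sets $E_0(\phi)=\{x\in X:\phi\in x\}$, $\phi\in\mathcal L$, and $T_i=\{d_i(\omega):\omega\in\Omega\}$ with the $\sigma$-algebra generated by $E_i(\phi)=\{t_i\in T_i:\phi\in t_i\}$, $\phi\in\mathcal L$. For $(x,t)\in X\times T$ there is a unique description $D(x,t)\supseteq x\cup\bigcup_i t_i$; put $[\phi]=\{(x,t)\in X\times T:\phi\in D(x,t)\}$. Since $\Theta$ is dense in $[0,1]$, for each $t_i\in T_i$ there is exactly one probability measure $\mu$ on $X\times T$ such that for all $\phi\in\mathcal L$ and $\theta\in\Theta$: $\mu([\phi])\ge\theta\iff B_i^\theta\phi\in t_i$; $\beta_i(t_i)$ is defined to be this measure. -}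

module Defs where

open import Axiom.ExcludedMiddle using (ExcludedMiddle)
open import Data.Empty using (⊥; ⊥-elim)
open import Data.Fin using (Fin)
open import Data.Integer as ℤ using (+_)
import Data.Integer.Properties as ℤ
open import Data.Maybe using (Maybe; just; nothing; fromMaybe)
open import Data.Nat as ℕ using (ℕ; zero)
import Data.Nat.Properties as ℕ
open import Data.Product using (_×_; _,_; ∃; ∃-syntax; ∃!; Σ-syntax; proj₁; proj₂)
open import Data.Rational as ℚ using (ℚ; 0ℚ; 1ℚ)
import Data.Rational.Properties as ℚ
open import Data.Rational.Solver using (module +-*-Solver)
import Data.Rational.Unnormalised as ℚᵘ
import Data.Rational.Unnormalised.Properties as ℚᵘ
open import Data.Sum using (_⊎_; inj₁; inj₂; [_,_]′)
open import Data.Unit using (⊤; tt)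
open import Function using (_∘_; id; _⇔_; mk⇔; Equivalence)
open import Level using (Level; 0ℓ; suc; _⊔_)
open import Relation.Binary.Definitions using (tri<; tri≈; tri>)
open import Relation.Binary.PropositionalEquality using (_≡_; _≢_; refl; sym; trans; cong; cong₂; subst; subst₂)
open import Relation.Nullary using (¬_; yes; no; contradiction; decidable-stable)
open import Relation.Unary hiding (Satisfiable) renaming (_⊥_ to _disjoint_)

private
  variable
    a c c′ g ℓ p s s′ : Level

-- Dedekind cuts, given by their lower halves.
record ℝ : Set₁ where
  no-eta-equality
  field
    cut       : Pred ℚ 0ℓ
    inhabited : ∃[ q ] q ∈ cut
    bounded   : ∃[ q ] q ∉ cut
    lower     : ∀ {p q} → p ℚ.≤ q → q ∈ cut → p ∈ cut
    rounded   : ∀ {p} → p ∈ cut → ∃[ q ] p ℚ.< q × q ∈ cut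

open ℝ public

infix 4 _≤_ _<_ _≈_
infixl 6 _+_

record _≤_ (x y : ℝ) : Set where
  constructor ≤⁺
  field
    ≤⁻ : cut x ⊆ cut y

open _≤_ public

_<_ _≈_ : ℝ → ℝ → Set
x < y = ∃[ q ] q ∈ cut y × q ∉ cut x
x ≈ y = x ≤ y × y ≤ x

∉⇒> : ∀ (x : ℝ) {p q} → p ∈ cut x → q ∉ cut x → p ℚ.< q
∉⇒> x p∈x q∉x = ℚ.≰⇒> λ q≤p → q∉x (lower x q≤p p∈x)

fromℚ : ℚ → ℝ
fromℚ q .cut       = ℚ._< q
fromℚ q .inhabited =
  q ℚ.- 1ℚ , subst (q ℚ.- 1ℚ ℚ.<_) (ℚ.+-identityʳ q) (ℚ.+-monoʳ-< q (ℚ.negative⁻¹ (ℚ.- 1ℚ)))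
fromℚ q .bounded   = q , ℚ.<-irrefl refl
fromℚ q .lower     = ℚ.≤-<-trans
fromℚ q .rounded   = ℚ.<-dense

0ℝ 1ℝ : ℝ
0ℝ = fromℚ 0ℚ
1ℝ = fromℚ 1ℚ

_+_ : ℝ → ℝ → ℝ
(x + y) .cut q     = ∃[ a ] ∃[ b ] a ∈ cut x × b ∈ cut y × q ℚ.≤ a ℚ.+ b
(x + y) .inhabited =
  let a , a∈x = inhabited x
      b , b∈y = inhabited y
  in a ℚ.+ b , a , b , a∈x , b∈y , ℚ.≤-refl
(x + y) .bounded   =
  let p , p∉x = bounded x
      q , q∉y = bounded y
  in p ℚ.+ q , λ (a , b , a∈x , b∈y , p+q≤a+b) →
       ℚ.<-irrefl refl (ℚ.<-≤-trans (ℚ.+-mono-< (∉⇒> x a∈x p∉x) (∉⇒> y b∈y q∉y)) p+q≤a+b)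
(x + y) .lower p≤q (a , b , a∈x , b∈y , q≤a+b) = a , b , a∈x , b∈y , ℚ.≤-trans p≤q q≤a+b
(x + y) .rounded (a , b , a∈x , b∈y , p≤a+b)   =
  let a′ , a<a′ , a′∈x = rounded x a∈x
  in a′ ℚ.+ b , ℚ.≤-<-trans p≤a+b (ℚ.+-monoˡ-< b a<a′) , a′ , b , a′∈x , b∈y , ℚ.≤-refl

IsSupremum IsInfimum : Pred ℝ ℓ → ℝ → Set (suc 0ℓ ⊔ ℓ)
IsSupremum P s = (∀ {r} → r ∈ P → r ≤ s) × (∀ {u} → (∀ {r} → r ∈ P → r ≤ u) → s ≤ u)
IsInfimum  P s = (∀ {r} → r ∈ P → s ≤ r) × (∀ {u} → (∀ {r} → r ∈ P → u ≤ r) → u ≤ s)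

partialSum : (ℕ → ℝ) → ℕ → ℝ
partialSum f zero      = 0ℝ
partialSum f (ℕ.suc n) = partialSum f n + f n

-- Only used for series of non-negative terms.
_SumsTo_ : (ℕ → ℝ) → ℝ → Set₁
f SumsTo s = IsSupremum (λ r → ∃[ n ] r ≡ partialSum f n) s

private
  open +-*-Solver using (solve; _:=_; _:+_; _:-_)

  [c+[b-c]]≡b : ∀ c b → c ℚ.+ (b ℚ.- c) ≡ b
  [c+[b-c]]≡b = solve 2 (λ c b → c :+ (b :- c) := b) refl

  [c+[p-q]]+q≡c+p : ∀ c p q → (c ℚ.+ (p ℚ.- q)) ℚ.+ q ≡ c ℚ.+ p
  [c+[p-q]]+q≡c+p = solve 3 (λ c p q → (c :+ (p :- q)) :+ q := c :+ p) refl

  p-q<0 : ∀ {p q} → p ℚ.< q → p ℚ.- q ℚ.< 0ℚ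
  p-q<0 {p} {q} p<q = subst (p ℚ.- q ℚ.<_) (ℚ.+-inverseʳ q) (ℚ.+-monoˡ-< (ℚ.- q) p<q)

  0<q-p : ∀ {p q} → p ℚ.< q → 0ℚ ℚ.< q ℚ.- p
  0<q-p {p} {q} p<q = subst (ℚ._< q ℚ.- p) (ℚ.+-inverseʳ p) (ℚ.+-monoˡ-< (ℚ.- p) p<q)

≤-refl : ∀ {x} → x ≤ x
≤-refl = ≤⁺ id

≤-trans : ∀ {x y z} → x ≤ y → y ≤ z → x ≤ z
≤-trans (≤⁺ f) (≤⁺ g) = ≤⁺ (g ∘ f)

≈-refl : ∀ {x} → x ≈ x
≈-refl = ≤-refl , ≤-refl

≈-sym : ∀ {x y} → x ≈ y → y ≈ x
≈-sym (x≤y , y≤x) = y≤x , x≤y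

≈-trans : ∀ {x y z} → x ≈ y → y ≈ z → x ≈ z
≈-trans (x≤y , y≤x) (y≤z , z≤y) = ≤-trans x≤y y≤z , ≤-trans z≤y y≤x

+-mono-≤ : ∀ {x x′ y y′} → x ≤ x′ → y ≤ y′ → x + y ≤ x′ + y′
+-mono-≤ (≤⁺ f) (≤⁺ g) = ≤⁺ λ (a , b , a∈x , b∈y , q≤a+b) → a , b , f a∈x , g b∈y , q≤a+b

x+0≤x : ∀ {x} → x + 0ℝ ≤ x
x+0≤x {x} = ≤⁺ λ (a , b , a∈x , b<0 , q≤a+b) →
  lower x (ℚ.≤-trans q≤a+b (subst (a ℚ.+ b ℚ.≤_) (ℚ.+-identityʳ a) (ℚ.+-monoʳ-≤ a (ℚ.<⇒≤ b<0)))) a∈x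

x≤x+y : ∀ {x y} → 0ℝ ≤ y → x ≤ x + y
x≤x+y {x} {y} (≤⁺ 0≤y) = ≤⁺ λ {p} p∈x →
  let q , p<q , q∈x = rounded x p∈x
  in q , p ℚ.- q , q∈x , 0≤y (p-q<0 p<q) , ℚ.≤-reflexive (sym ([c+[b-c]]≡b q p))

+-comm-≤ : ∀ {x y} → x + y ≤ y + x
+-comm-≤ = ≤⁺ λ {q} (a , b , a∈x , b∈y , q≤a+b) → b , a , b∈y , a∈x , subst (q ℚ.≤_) (ℚ.+-comm a b) q≤a+b

x≤0+x : ∀ {x} → x ≤ 0ℝ + x
x≤0+x = ≤-trans (x≤x+y ≤-refl) +-comm-≤

0+x≤x : ∀ {x} → 0ℝ + x ≤ x
0+x≤x = ≤-trans +-comm-≤ x+0≤x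

multiple : ℕ → ℚ → ℚ
multiple zero      ε = 0ℚ
multiple (ℕ.suc n) ε = ε ℚ.+ multiple n ε

archimedean : ∀ δ {ε} → 0ℚ ℚ.< ε → ∃[ n ] δ ℚ.≤ multiple n ε
archimedean δ {ε} 0<ε = n , subst₂ ℚ._≤_ δ-eq (n-eq n) (ℚ.*-monoʳ-≤-nonNeg ε {{ℚ.nonNegative (ℚ.<⇒≤ 0<ε)}} r≤n)
  where
  instance
    ε≢0 : ℚ.NonZero ε
    ε≢0 = ℚ.>-nonZero 0<ε
  r = δ ℚ.* (ℚ.1/ ε)
  n = ℤ.∣ ℚ.↥ r ∣
  fromℕ : ℕ → ℚ
  fromℕ zero      = 0ℚ
  fromℕ (ℕ.suc k) = 1ℚ ℚ.+ fromℕ k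
  δ-eq : r ℚ.* ε ≡ δ
  δ-eq = trans (ℚ.*-assoc δ (ℚ.1/ ε) ε) (trans (cong (δ ℚ.*_) (ℚ.*-inverseˡ ε)) (ℚ.*-identityʳ δ))
  n-eq : ∀ k → fromℕ k ℚ.* ε ≡ multiple k ε
  n-eq zero      = ℚ.*-zeroˡ ε
  n-eq (ℕ.suc k) = trans (ℚ.*-distribʳ-+ ε 1ℚ (fromℕ k)) (cong₂ ℚ._+_ (ℚ.*-identityˡ ε) (n-eq k))
  fromℕ≃ : ∀ k → ℚ.toℚᵘ (fromℕ k) ℚᵘ.≃ ℚᵘ.mkℚᵘ (+ k) 0
  fromℕ≃ zero      = ℚᵘ.≃-refl
  fromℕ≃ (ℕ.suc k) = ℚᵘ.≃-trans (ℚ.toℚᵘ-homo-+ 1ℚ (fromℕ k))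
    (ℚᵘ.≃-trans (ℚᵘ.+-congʳ (ℚ.toℚᵘ 1ℚ) (fromℕ≃ k))
      (ℚᵘ.*≡* (cong (λ j → (+ 1 ℤ.+ j) ℤ.* + 1) (ℤ.*-identityʳ (+ k)))))
  ≤∣↥∣ : ∀ p → ℚ.toℚᵘ p ℚᵘ.≤ ℚᵘ.mkℚᵘ (+ ℤ.∣ ℚ.↥ p ∣) 0
  ≤∣↥∣ (ℚ.mkℚ (+ m)      d _) = ℚᵘ.*≤* (ℤ.*-monoˡ-≤-nonNeg (+ m) (ℤ.+≤+ (ℕ.s≤s ℕ.z≤n)))
  ≤∣↥∣ (ℚ.mkℚ ℤ.-[1+ m ] d _) = ℚᵘ.*≤* ℤ.-≤+
  r≤n : r ℚ.≤ fromℕ n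
  r≤n = ℚ.toℚᵘ-cancel-≤ (ℚᵘ.≤-trans (≤∣↥∣ r) (ℚᵘ.≤-reflexive (ℚᵘ.≃-sym (fromℕ≃ n))))

module _ (em : ∀ {ℓ} → ExcludedMiddle ℓ) where

  gap : ∀ z {ε} → 0ℚ ℚ.< ε → ∃[ c ] c ∈ cut z × c ℚ.+ ε ∉ cut z
  gap z {ε} 0<ε with inhabited z | bounded z
  ... | c₀ , c₀∈z | b , b∉z with archimedean (b ℚ.- c₀) 0<ε
  ...   | n , b-c₀≤nε = search n c₀ c₀∈z λ c₀+nε∈z → b∉z (lower z b≤c₀+nε c₀+nε∈z)
    where
    b≤c₀+nε : b ℚ.≤ c₀ ℚ.+ multiple n ε
    b≤c₀+nε = subst (ℚ._≤ c₀ ℚ.+ multiple n ε) ([c+[b-c]]≡b c₀ b) (ℚ.+-monoʳ-≤ c₀ b-c₀≤nε)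

    search : ∀ n c → c ∈ cut z → c ℚ.+ multiple n ε ∉ cut z → ∃[ c ] c ∈ cut z × c ℚ.+ ε ∉ cut z
    search zero      c c∈z c+0∉z = contradiction (subst (cut z) (sym (ℚ.+-identityʳ c)) c∈z) c+0∉z
    search (ℕ.suc n) c c∈z c+∉z with em {P = c ℚ.+ ε ∈ cut z}
    ... | yes c+ε∈z = search n (c ℚ.+ ε) c+ε∈z (subst (_∉ cut z) (sym (ℚ.+-assoc c ε (multiple n ε))) c+∉z)
    ... | no  c+ε∉z = c , c∈z , c+ε∉z

  +-cancel-≤ : ∀ {x y z z′} → z′ ≤ z → z + x ≤ z′ + y → x ≤ y
  +-cancel-≤ {x} {y} {z} {z′} (≤⁺ z′≤z) (≤⁺ z+x≤z′+y) = ≤⁺ λ {q} q∈x → decidable-stable em λ q∉y →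
    let p , q<p , p∈x = rounded x q∈x
        c , c∈z , c+ε∉z = gap z (0<q-p q<p)
        a , b , a∈z′ , b∈y , c+p≤a+b = z+x≤z′+y (c , p , c∈z , p∈x , ℚ.≤-refl)
        a+b<c+p = subst (a ℚ.+ b ℚ.<_) ([c+[p-q]]+q≡c+p c p q)
                    (ℚ.+-mono-< (∉⇒> z (z′≤z a∈z′) c+ε∉z) (∉⇒> y b∈y q∉y))
    in ℚ.<-irrefl refl (ℚ.<-≤-trans a+b<c+p c+p≤a+b)

-- Closure under ∩ is redundant under excluded middle. It is included so that truth sets can be
-- defined without it.
record IsσAlgebra {Y : Set c} (𝓢 : Pred (Pred Y 0ℓ) s) : Set (suc 0ℓ ⊔ c ⊔ s) where
  field
    resp  : ∀ {A B} → A ≐ B → A ∈ 𝓢 → B ∈ 𝓢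
    whole : U ∈ 𝓢
    compl : ∀ {A} → A ∈ 𝓢 → ∁ A ∈ 𝓢
    inter : ∀ {A B} → A ∈ 𝓢 → B ∈ 𝓢 → A ∩ B ∈ 𝓢
    union : ∀ {A : ℕ → Pred Y 0ℓ} → (∀ k → A k ∈ 𝓢) → ⋃ ℕ A ∈ 𝓢

record MeasurableSpace c s : Set (suc (c ⊔ s)) where
  field
    Carrier    : Set c
    𝓢          : Pred (Pred Carrier 0ℓ) s
    isσAlgebra : IsσAlgebra 𝓢

  open IsσAlgebra isσAlgebra public

open MeasurableSpace using (Carrier; 𝓢)

data Generated {Y : Set c} (G : Pred (Pred Y 0ℓ) g) : Pred (Pred Y 0ℓ) (suc 0ℓ ⊔ c ⊔ g) where
  base  : ∀ {A} → A ∈ G → Generated G A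
  resp  : ∀ {A B} → A ≐ B → Generated G A → Generated G B
  whole : Generated G U
  compl : ∀ {A} → Generated G A → Generated G (∁ A)
  inter : ∀ {A B} → Generated G A → Generated G B → Generated G (A ∩ B)
  union : ∀ {A : ℕ → Pred Y 0ℓ} → (∀ k → Generated G (A k)) → Generated G (⋃ ℕ A)

generatedBy : {Y : Set c} → Pred (Pred Y 0ℓ) g → MeasurableSpace c (suc 0ℓ ⊔ c ⊔ g)
generatedBy {Y = Y} G = record
  { Carrier    = Y
  ; 𝓢          = Generated G
  ; isσAlgebra = record { resp = resp ; whole = whole ; compl = compl ; inter = inter ; union = union }
  }

-- Events are Set₀-valued whatever the level of the carrier. Under excluded middle this loses no
-- subsets.
record Event (Y : MeasurableSpace c s) : Set (suc 0ℓ ⊔ c ⊔ s) where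
  constructor event
  field
    set        : Pred (Carrier Y) 0ℓ
    measurable : set ∈ 𝓢 Y

open Event public

module _ (Y : MeasurableSpace c s) where
  private module Y = MeasurableSpace Y

  wholeᴱ : Event Y
  wholeᴱ = event U Y.whole

  ∁ᴱ : Event Y → Event Y
  ∁ᴱ (event _ A∈𝓢) = event _ (Y.compl A∈𝓢)

  emptyᴱ : Event Y
  emptyᴱ = event ∅ (Y.resp ((λ y∉U → y∉U tt) , λ ()) (Y.compl Y.whole))

  _∩ᴱ_ : Event Y → Event Y → Event Y
  event _ A∈𝓢 ∩ᴱ event _ B∈𝓢 = event _ (Y.inter A∈𝓢 B∈𝓢)

  ⋃ᴱ : (ℕ → Event Y) → Event Y
  ⋃ᴱ E = event (⋃ ℕ (set ∘ E)) (Y.union (measurable ∘ E))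

Measurable : (Y : MeasurableSpace c s) (Z : MeasurableSpace c′ s′) → (Carrier Y → Carrier Z) →
             Set (suc 0ℓ ⊔ s ⊔ c′ ⊔ s′)
Measurable Y Z f = ∀ {A} → A ∈ 𝓢 Z → f ⊢ A ∈ 𝓢 Y

record ProbabilityMeasure (Y : MeasurableSpace c s) : Set (suc 0ℓ ⊔ c ⊔ s) where
  field
    prob     : Event Y → ℝ
    prob-≐   : ∀ E F → set E ≐ set F → prob E ≈ prob F
    nonneg   : ∀ E → 0ℝ ≤ prob E
    null     : prob (emptyᴱ Y) ≈ 0ℝ
    total    : prob (wholeᴱ Y) ≈ 1ℝ
    additive : ∀ E → (∀ {j k} → j ≢ k → set (E j) disjoint set (E k)) →
               (prob ∘ E) SumsTo prob (⋃ᴱ Y E)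

open ProbabilityMeasure public

infix 4 _≈ₘ_
_≈ₘ_ : {Y : MeasurableSpace c s} → ProbabilityMeasure Y → ProbabilityMeasure Y → Set (suc 0ℓ ⊔ c ⊔ s)
μ ≈ₘ ν = ∀ E → prob μ E ≈ prob ν E

module _ (Y : MeasurableSpace c s) where

  AtLeast : ℝ → Event Y → Pred (ProbabilityMeasure Y) 0ℓ
  AtLeast θ E μ = θ ≤ prob μ E

  Δ : MeasurableSpace (suc 0ℓ ⊔ c ⊔ s) (suc 0ℓ ⊔ c ⊔ s)
  Δ = generatedBy λ A → ∃[ θ ] ∃[ E ] 0ℝ ≤ θ × θ ≤ 1ℝ × A ≐ AtLeast θ E

-- The relation μ*(A) = r.
IsOuterMeasure : {Y : MeasurableSpace c s} → ProbabilityMeasure Y → Pred (Carrier Y) a → ℝ →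
                 Set (suc 0ℓ ⊔ c ⊔ s ⊔ a)
IsOuterMeasure μ A r = IsInfimum (λ x → ∃[ E ] A ⊆ set E × x ≡ prob μ E) r

IsDirac : {Y : MeasurableSpace c s} → Carrier Y → ProbabilityMeasure Y → Set (suc 0ℓ ⊔ c ⊔ s)
IsDirac y μ = ∀ E → (y ∈ set E → prob μ E ≈ 1ℝ) × (y ∉ set E → prob μ E ≈ 0ℝ)

SumsTo-≈ : ∀ {f f′ x x′} → (∀ k → f k ≈ f′ k) → x ≈ x′ → f SumsTo x → f′ SumsTo x′
SumsTo-≈ {f} {f′} f≈f′ (x≤x′ , x′≤x) (upper , least) =
    (λ { (n , refl) → ≤-trans (≤-trans (proj₂ (partial≈ n)) (upper (n , refl))) x≤x′ })
  , (λ upper′ → ≤-trans x′≤x (least λ { (n , refl) → ≤-trans (proj₁ (partial≈ n)) (upper′ (n , refl)) }))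
  where
  partial≈ : ∀ n → partialSum f n ≈ partialSum f′ n
  partial≈ zero      = ≈-refl
  partial≈ (ℕ.suc n) = +-mono-≤ (proj₁ (partial≈ n)) (proj₁ (f≈f′ n))
                     , +-mono-≤ (proj₂ (partial≈ n)) (proj₂ (f≈f′ n))

module _ {Y : MeasurableSpace c s} {Z : MeasurableSpace c′ s′}
         (f : Carrier Y → Carrier Z) (f-measurable : Measurable Y Z f) where

  preimage : Event Z → Event Y
  preimage (event _ A∈𝓢) = event _ (f-measurable A∈𝓢)

  pushforward : ProbabilityMeasure Y → ProbabilityMeasure Z
  pushforward μ = record
    { prob     = prob μ ∘ preimage
    ; prob-≐   = λ E F (E⊆F , F⊆E) →
                   prob-≐ μ (preimage E) (preimage F) ((λ {y} → E⊆F {f y}) , λ {y} → F⊆E {f y})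
    ; nonneg   = nonneg μ ∘ preimage
    ; null     = ≈-trans (prob-≐ μ _ _ (id , id)) (null μ)
    ; total    = ≈-trans (prob-≐ μ _ _ (id , id)) (total μ)
    ; additive = λ E disj → SumsTo-≈ (λ _ → prob-≐ μ _ _ (id , id)) (prob-≐ μ _ _ (id , id))
                   (additive μ (preimage ∘ E) λ j≢k {y} → disj j≢k {f y})
    }

generated-measurable : {Y : MeasurableSpace c s} {Z : Set c′} {G : Pred (Pred Z 0ℓ) g} {f : Carrier Y → Z} →
                       (∀ {A} → A ∈ G → f ⊢ A ∈ 𝓢 Y) → Measurable Y (generatedBy G) f
generated-measurable {Y = Y} {G = G} {f = f} gens = go
  where
  module Y = MeasurableSpace Y
  go : Measurable Y (generatedBy G) f
  go (base A∈G)               = gens A∈G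
  go (resp (A⊆B , B⊆A) A∈)    = Y.resp ((λ {y} → A⊆B {f y}) , λ {y} → B⊆A {f y}) (go A∈)
  go whole                    = Y.whole
  go (compl A∈)               = Y.compl (go A∈)
  go (inter A∈ B∈)            = Y.inter (go A∈) (go B∈)
  go (union A∈)               = Y.union (go ∘ A∈)

-- X × ∏ᵢ Tᵢ with the σ-algebra generated by the projections.
module _ {n} (X : MeasurableSpace c s) (T : Fin n → MeasurableSpace c s) where

  X×T : Set c
  X×T = Carrier X × (∀ i → Carrier (T i))

  data Cylinder : Pred (Pred X×T 0ℓ) (suc 0ℓ ⊔ c ⊔ s) where
    cyl₀ : ∀ {A} → A ∈ 𝓢 X → Cylinder (proj₁ ⊢ A)
    cylᵢ : ∀ i {A} → A ∈ 𝓢 (T i) → Cylinder ((λ (_ , t) → t i) ⊢ A)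

  Product : MeasurableSpace c (suc 0ℓ ⊔ c ⊔ s)
  Product = generatedBy Cylinder

  marginal : ∀ i → ProbabilityMeasure Product → ProbabilityMeasure (T i)
  marginal i = pushforward (λ (_ , t) → t i) (λ A∈𝓢 → base (cylᵢ i A∈𝓢))

data Dynkin {Y : Set c} (G : Pred (Pred Y 0ℓ) g) : Pred (Pred Y 0ℓ) (suc 0ℓ ⊔ c ⊔ g) where
  base   : ∀ {A} → A ∈ G → Dynkin G A
  resp   : ∀ {A A′} → A ≐ A′ → Dynkin G A → Dynkin G A′
  whole  : Dynkin G U
  compl  : ∀ {A} → Dynkin G A → Dynkin G (∁ A)
  dunion : ∀ {A : ℕ → Pred Y 0ℓ} → (∀ {j k} → j ≢ k → A j disjoint A k) → (∀ k → Dynkin G (A k)) →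
           Dynkin G (⋃ ℕ A)

pair : {A : Set a} → A → A → A → ℕ → A
pair x y z zero              = x
pair x y z (ℕ.suc zero)      = y
pair x y z (ℕ.suc (ℕ.suc _)) = z

pair-disjoint : {Y : Set c} {A : Set a} (f : A → Pred Y 0ℓ) {x y z : A} → f x disjoint f y → f z ⊆ ∅ →
                ∀ {j k} → j ≢ k → f (pair x y z j) disjoint f (pair x y z k)
pair-disjoint f d e {zero}              {zero}              j≢k _       = j≢k refl
pair-disjoint f d e {zero}              {ℕ.suc zero}        j≢k (p , q) = d (p , q)
pair-disjoint f d e {zero}              {ℕ.suc (ℕ.suc k)}   j≢k (p , q) = e q
pair-disjoint f d e {ℕ.suc zero}        {zero}              j≢k (p , q) = d (q , p)
pair-disjoint f d e {ℕ.suc zero}        {ℕ.suc zero}        j≢k _       = j≢k refl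
pair-disjoint f d e {ℕ.suc zero}        {ℕ.suc (ℕ.suc k)}   j≢k (p , q) = e q
pair-disjoint f d e {ℕ.suc (ℕ.suc j)}   {_}                 j≢k (p , q) = e p

module _ (em : ∀ {ℓ} → ExcludedMiddle ℓ) where

  module _ {Y : Set c} {G : Pred (Pred Y 0ℓ) g} (∩-closed : ∀ {A A′} → A ∈ G → A′ ∈ G → A ∩ A′ ∈ G) where

    private
      D = Dynkin G

      D-∅ : D ∅
      D-∅ = resp ((λ y∉U → y∉U tt) , λ ()) (compl whole)

      D-⊎ : ∀ {A A′} → A disjoint A′ → D A → D A′ → D (A ∪ A′)
      D-⊎ {A} {A′} d DA DA′ = resp
        ( (λ { (zero , p) → inj₁ p ; (ℕ.suc zero , p) → inj₂ p ; (ℕ.suc (ℕ.suc _) , ()) })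
        , [ (zero ,_) , (1 ,_) ]′ )
        (dunion {A = pair A A′ ∅} (pair-disjoint id {A} {A′} {∅} d id)
                (λ { zero → DA ; (ℕ.suc zero) → DA′ ; (ℕ.suc (ℕ.suc _)) → D-∅ }))

      D-∩-step : ∀ {A′} → D A′ → (∀ {A} → A ∈ G → D (A ∩ A′)) → ∀ {A} → D A → D (A ∩ A′)
      D-∩-step DA′ gens (base A∈G)                = gens A∈G
      D-∩-step DA′ gens (resp (f , g) DA)         =
        resp ((λ (p , q) → f p , q) , λ (p , q) → g p , q) (D-∩-step DA′ gens DA)
      D-∩-step DA′ gens whole                     = resp ((tt ,_) , proj₂) DA′
      D-∩-step DA′ gens (compl {A} DA)            = resp
        ( (λ n → (λ p → n (inj₂ λ q → n (inj₁ (p , q)))) ∘ id , decidable-stable em (n ∘ inj₂))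
        , (λ (p , q) → [ p ∘ proj₁ , (λ ¬q → ¬q q) ]′) )
        (compl (D-⊎ (λ ((_ , q) , ¬q) → ¬q q) (D-∩-step DA′ gens DA) (compl DA′)))
      D-∩-step DA′ gens (dunion disj DA)          = resp
        ((λ (k , p , q) → (k , p) , q) , λ ((k , p) , q) → k , p , q)
        (dunion (λ j≢k ((p , _) , (q , _)) → disj j≢k (p , q)) (D-∩-step DA′ gens ∘ DA))

      ∩-swap : ∀ {A A′ : Pred Y 0ℓ} → A ∩ A′ ≐ A′ ∩ A
      ∩-swap = (λ (p , q) → q , p) , λ (p , q) → q , p

      D-∩ : ∀ {A A′} → D A → D A′ → D (A ∩ A′)
      D-∩ DA DA′ = D-∩-step DA′
        (λ A∈G → resp ∩-swap (D-∩-step (base A∈G) (λ A′∈G → base (∩-closed A′∈G A∈G)) DA′)) DA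

      module _ (A : ℕ → Pred Y 0ℓ) where
        none : ℕ → Pred Y 0ℓ
        none zero      = U
        none (ℕ.suc k) = none k ∩ ∁ (A k)

        first : ℕ → Pred Y 0ℓ
        first k = A k ∩ none k

        none⇒∉ : ∀ {y j k} → y ∈ none k → j ℕ.< k → y ∉ A j
        none⇒∉ {j = j} {ℕ.suc k} (none-k , ∉k) j<1+k y∈Aj with ℕ.m≤n⇒m<n∨m≡n (ℕ.s≤s⁻¹ j<1+k)
        ... | inj₁ j<k  = none⇒∉ none-k j<k y∈Aj
        ... | inj₂ refl = ∉k y∈Aj

        first-disjoint : ∀ {j k} → j ≢ k → first j disjoint first k
        first-disjoint {j} {k} j≢k ((p , nj) , (q , nk)) with ℕ.<-cmp j k
        ... | tri< j<k _ _  = none⇒∉ nk j<k p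
        ... | tri≈ _ j≡k _  = j≢k j≡k
        ... | tri> _ _ k<j  = none⇒∉ nj k<j q

        search : ∀ k {y} → y ∈ none k ⊎ ∃[ j ] y ∈ first j
        search zero      = inj₁ tt
        search (ℕ.suc k) {y} with search k {y}
        ... | inj₂ found  = inj₂ found
        ... | inj₁ none-k with em {P = y ∈ A k}
        ...   | yes p = inj₂ (k , p , none-k)
        ...   | no ¬p = inj₁ (none-k , ¬p)

        D-⋃ : (∀ k → D (A k)) → D (⋃ ℕ A)
        D-⋃ DA = resp ((λ (k , p , _) → k , p) , λ (k , p) → [ (λ none-k → k , p , none-k) , id ]′ (search k))
          (dunion first-disjoint λ k → D-∩ (DA k) (D-none k))
          where
          D-none : ∀ k → D (none k)
          D-none zero      = whole
          D-none (ℕ.suc k) = D-∩ (D-none k) (compl (DA k))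

    Generated⊆Dynkin : Generated G ⊆ Dynkin G
    Generated⊆Dynkin (base A∈G)    = base A∈G
    Generated⊆Dynkin (resp A≐A′ A∈) = resp A≐A′ (Generated⊆Dynkin A∈)
    Generated⊆Dynkin whole         = whole
    Generated⊆Dynkin (compl A∈)    = compl (Generated⊆Dynkin A∈)
    Generated⊆Dynkin (inter A∈ B∈) = D-∩ (Generated⊆Dynkin A∈) (Generated⊆Dynkin B∈)
    Generated⊆Dynkin (union A∈)    = D-⋃ _ (Generated⊆Dynkin ∘ A∈)

  module _ {Y : MeasurableSpace c s} where

    prob-⊎ : (μ : ProbabilityMeasure Y) (E F : Event Y) → set E disjoint set F →
             prob μ (⋃ᴱ Y (pair E F (emptyᴱ Y))) ≈ prob μ E + prob μ F
    prob-⊎ μ E F d = least upper′ , ≤-trans (+-mono-≤ x≤0+x ≤-refl) (upper (2 , refl))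
      where
      f = prob μ ∘ pair E F (emptyᴱ Y)
      sums = additive μ (pair E F (emptyᴱ Y)) (pair-disjoint set {E} {F} {emptyᴱ Y} d id)
      upper = proj₁ sums
      least = proj₂ sums
      bound : ∀ k → partialSum f k ≤ prob μ E + prob μ F
      bound zero                         = ≤-trans (nonneg μ E) (x≤x+y (nonneg μ F))
      bound (ℕ.suc zero)                 = ≤-trans 0+x≤x (x≤x+y (nonneg μ F))
      bound (ℕ.suc (ℕ.suc zero))         = +-mono-≤ 0+x≤x ≤-refl
      bound (ℕ.suc (ℕ.suc (ℕ.suc k)))    =
        ≤-trans (+-mono-≤ (bound (ℕ.suc (ℕ.suc k))) (proj₁ (null μ))) x+0≤x
      upper′ : ∀ {r} → ∃[ k ] r ≡ partialSum f k → r ≤ prob μ E + prob μ F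
      upper′ (k , refl) = bound k

    prob-∁ : (μ : ProbabilityMeasure Y) (E : Event Y) → prob μ E + prob μ (∁ᴱ Y E) ≈ 1ℝ
    prob-∁ μ E = ≈-trans (≈-sym (prob-⊎ μ E (∁ᴱ Y E) λ (p , ¬p) → ¬p p))
                  (≈-trans (prob-≐ μ _ _ ((λ _ → tt) , λ {y} _ → cases y)) (total μ))
      where
      cases : ∀ y → y ∈ set (⋃ᴱ Y (pair E (∁ᴱ Y E) (emptyᴱ Y)))
      cases y with em {P = y ∈ set E}
      ... | yes p = 0 , p
      ... | no ¬p = 1 , ¬p

    prob≤1 : (μ : ProbabilityMeasure Y) (E : Event Y) → prob μ E ≤ 1ℝ
    prob≤1 μ E = ≤-trans (x≤x+y (nonneg μ (∁ᴱ Y E))) (proj₁ (prob-∁ μ E))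

    measure-unique : {G : Pred (Pred (Carrier Y) 0ℓ) g} → (∀ {A A′} → A ∈ G → A′ ∈ G → A ∩ A′ ∈ G) →
                     𝓢 Y ⊆ Generated G → (μ ν : ProbabilityMeasure Y) →
                     (∀ {A} → A ∈ G → Σ[ A∈𝓢 ∈ A ∈ 𝓢 Y ] prob μ (event A A∈𝓢) ≈ prob ν (event A A∈𝓢)) →
                     μ ≈ₘ ν
    measure-unique {G = G} ∩-closed 𝓢⊆ μ ν agree (event A A∈𝓢) =
      let A∈𝓢′ , eq = go (Generated⊆Dynkin ∩-closed (𝓢⊆ A∈𝓢))
      in ≈-trans (prob-≐ μ _ _ (id , id)) (≈-trans eq (prob-≐ ν _ _ (id , id)))
      where
      module Y = MeasurableSpace Y
      go : ∀ {A} → Dynkin G A → Σ[ A∈𝓢 ∈ A ∈ 𝓢 Y ] prob μ (event A A∈𝓢) ≈ prob ν (event A A∈𝓢)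
      go (base A∈G)      = agree A∈G
      go (resp A≐A′ DA)  =
        let A∈𝓢 , eq = go DA
        in Y.resp A≐A′ A∈𝓢 , ≈-trans (≈-sym (prob-≐ μ _ _ A≐A′)) (≈-trans eq (prob-≐ ν _ _ A≐A′))
      go whole           = Y.whole , ≈-trans (total μ) (≈-sym (total ν))
      go (compl DA)      =
        let A∈𝓢 , eq = go DA
            E = event _ A∈𝓢
            sums = ≈-trans (prob-∁ μ E) (≈-sym (prob-∁ ν E))
        in Y.compl A∈𝓢 , +-cancel-≤ em (proj₂ eq) (proj₁ sums) , +-cancel-≤ em (proj₁ eq) (proj₂ sums)
      go (dunion {A} disj DA) =
          Y.union (proj₁ ∘ go ∘ DA)
        , sup≤ μ ν (proj₁ ∘ proj₂ ∘ go ∘ DA)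
        , sup≤ ν μ (proj₂ ∘ proj₂ ∘ go ∘ DA)
        where
        E : ℕ → Event Y
        E k = event (A k) (proj₁ (go (DA k)))
        sup≤ : ∀ μ ν → (∀ k → prob μ (E k) ≤ prob ν (E k)) → prob μ (⋃ᴱ Y E) ≤ prob ν (⋃ᴱ Y E)
        sup≤ μ ν μE≤νE = proj₂ (additive μ E disj) λ { (k , refl) →
          ≤-trans (partial≤ k) (proj₁ (additive ν E disj) (k , refl)) }
          where
          partial≤ : ∀ k → partialSum (prob μ ∘ E) k ≤ partialSum (prob ν ∘ E) k
          partial≤ zero      = ≤-refl
          partial≤ (ℕ.suc k) = +-mono-≤ (partial≤ k) (μE≤νE k)

record CountableDenseSubset : Set₁ where
  field
    Member    : Pred ℝ 0ℓ
    resp-≈    : ∀ {x y} → x ≈ y → x ∈ Member → y ∈ Member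
    0≤        : ∀ {θ} → θ ∈ Member → 0ℝ ≤ θ
    ≤1        : ∀ {θ} → θ ∈ Member → θ ≤ 1ℝ
    countable : Σ[ e ∈ (ℕ → ℝ) ] (∀ k → e k ∈ Member) × (∀ {θ} → θ ∈ Member → ∃[ k ] e k ≈ θ)
    -- every open interval that meets [0,1] meets the subset
    dense     : ∀ {x y z} → 0ℝ ≤ x → x ≤ 1ℝ → y < x → x < z → ∃[ θ ] θ ∈ Member × y < θ × θ < z

open CountableDenseSubset

infixr 6 _∧′_
data Formula (n : ℕ) (Φ : Set p) (Θ : CountableDenseSubset) : Set (suc 0ℓ ⊔ p) where
  atom : Φ → Formula n Φ Θ
  ¬′_  : Formula n Φ Θ → Formula n Φ Θ
  _∧′_ : Formula n Φ Θ → Formula n Φ Θ → Formula n Φ Θ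
  B    : Fin n → ∃ (Member Θ) → Formula n Φ Θ → Formula n Φ Θ

record TypeStructure (n : ℕ) c s : Set (suc (suc 0ℓ ⊔ c ⊔ s)) where
  field
    X : MeasurableSpace c s
    T : Fin n → MeasurableSpace c s
    β : ∀ i → Carrier (T i) → ProbabilityMeasure (Product X T)

record IsTypeSpace {n : ℕ} (𝒯 : TypeStructure n c s) : Set (suc 0ℓ ⊔ c ⊔ s) where
  open TypeStructure 𝒯
  field
    β-measurable : ∀ i → Measurable (T i) (Δ (Product X T)) (β i)
    β-marginal   : ∀ i t → IsDirac t (marginal X T i (β i t))

record InterpretedTypeSpace (n : ℕ) (Φ : Set p) c s : Set (suc (suc 0ℓ ⊔ c ⊔ s) ⊔ p) where
  field
    typeStructure : TypeStructure n c s
    isTypeSpace   : IsTypeSpace typeStructure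

  open TypeStructure typeStructure public
  open IsTypeSpace isTypeSpace public

  field
    ν : Φ → Event X

record ProbabilityFrame (n : ℕ) c s : Set (suc (suc 0ℓ ⊔ c ⊔ s)) where
  field
    Ω             : MeasurableSpace c s
    Pr            : Fin n → Carrier Ω → ProbabilityMeasure Ω
    Pr-measurable : ∀ i → Measurable Ω (Δ Ω) (Pr i)
    introspective : ∀ i ω → IsOuterMeasure (Pr i ω) (λ ω′ → Pr i ω′ ≈ₘ Pr i ω) 1ℝ

record ProbabilityModel (n : ℕ) (Φ : Set p) c s : Set (suc (suc 0ℓ ⊔ c ⊔ s) ⊔ p) where
  field
    frame : ProbabilityFrame n c s

  open ProbabilityFrame frame public

  field
    π : Φ → Event Ω

module _ {n : ℕ} {Φ : Set p} {Θ : CountableDenseSubset} where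

  infix 25 _⟦_⟧ _⟦_⟧ᴵ

  _⟦_⟧ : (M : ProbabilityModel n Φ c s) → Formula n Φ Θ → Event (ProbabilityModel.Ω M)
  M ⟦ atom q ⟧              = ProbabilityModel.π M q
  M ⟦ ¬′ φ ⟧                = ∁ᴱ _ (M ⟦ φ ⟧)
  M ⟦ φ ∧′ ψ ⟧              = _∩ᴱ_ _ (M ⟦ φ ⟧) (M ⟦ ψ ⟧)
  M ⟦ B i (θ , θ∈Θ) φ ⟧     = event (λ ω → θ ≤ prob (Pr i ω) (M ⟦ φ ⟧))
    (Pr-measurable i (base (θ , M ⟦ φ ⟧ , 0≤ Θ θ∈Θ , ≤1 Θ θ∈Θ , id , id)))
    where open ProbabilityModel M

  _⟦_⟧ᴵ : (ℐ : InterpretedTypeSpace n Φ c s) → Formula n Φ Θ →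
          Event (Product (InterpretedTypeSpace.X ℐ) (InterpretedTypeSpace.T ℐ))
  ℐ ⟦ atom q ⟧ᴵ             = event (proj₁ ⊢ set (ν q)) (base (cyl₀ (measurable (ν q))))
    where open InterpretedTypeSpace ℐ
  ℐ ⟦ ¬′ φ ⟧ᴵ               = ∁ᴱ _ (ℐ ⟦ φ ⟧ᴵ)
  ℐ ⟦ φ ∧′ ψ ⟧ᴵ             = _∩ᴱ_ _ (ℐ ⟦ φ ⟧ᴵ) (ℐ ⟦ ψ ⟧ᴵ)
  ℐ ⟦ B i (θ , θ∈Θ) φ ⟧ᴵ    = event (λ (x , t) → θ ≤ prob (β i (t i)) (ℐ ⟦ φ ⟧ᴵ))
    (base (cylᵢ i (β-measurable i (base (θ , ℐ ⟦ φ ⟧ᴵ , 0≤ Θ θ∈Θ , ≤1 Θ θ∈Θ , id , id)))))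
    where open InterpretedTypeSpace ℐ

  Propositional : Pred (Formula n Φ Θ) 0ℓ
  Propositional (atom _)   = ⊤
  Propositional (¬′ φ)     = Propositional φ
  Propositional (φ ∧′ ψ)   = Propositional φ × Propositional ψ
  Propositional (B _ _ _)  = ⊥

  -- Boolean combinations of formulas of the form B i θ φ.
  BeliefsOf : Fin n → Pred (Formula n Φ Θ) 0ℓ
  BeliefsOf i (atom _)   = ⊥
  BeliefsOf i (¬′ φ)     = BeliefsOf i φ
  BeliefsOf i (φ ∧′ ψ)   = BeliefsOf i φ × BeliefsOf i ψ
  BeliefsOf i (B j _ _)  = j ≡ i

  Satisfiable : ∀ c s → Pred (Pred (Formula n Φ Θ) 0ℓ) _
  Satisfiable c s S = Σ[ M ∈ ProbabilityModel n Φ c s ] ∃[ ω ] ∀ {φ} → φ ∈ S → ω ∈ set (M ⟦ φ ⟧)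

  IsDescription : ∀ c s → Pred (Pred (Formula n Φ Θ) 0ℓ) _
  IsDescription c s D = Satisfiable c s D × (∀ φ → φ ∈ D ⊎ ¬′ φ ∈ D)

≤-from-thresholds : (∀ {ℓ} → ExcludedMiddle ℓ) → ∀ Θ {x y} → x ≤ 1ℝ → 0ℝ ≤ y →
                    (∀ {θ} → θ ∈ Member Θ → θ ≤ x → θ ≤ y) → x ≤ y
≤-from-thresholds em Θ {x} {y} x≤1 0≤y below = ≤⁺ λ {q} q∈x → decidable-stable em λ q∉y →
  let r , q<r , r∈x = rounded x q∈x
      θ , θ∈Θ , y<θ , (p , p∈x , p∉θ) = dense Θ {fromℚ r} {y} {x}
        (≤⁺ λ {p} p<0 → ℚ.<-trans (∉⇒> y (≤⁻ 0≤y p<0) q∉y) q<r)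
        (≤⁺ λ {p} p<r → ≤⁻ x≤1 (lower x (ℚ.<⇒≤ p<r) r∈x))
        (q , q<r , q∉y)
        (r , r∈x , ℚ.<-irrefl refl)
      p′ , p′∈θ , p′∉y = y<θ
  in p′∉y (≤⁻ (below θ∈Θ (≤⁺ λ t∈θ → lower x (ℚ.<⇒≤ (∉⇒> θ t∈θ p∉θ)) p∈x)) p′∈θ)

-- A model with one more world, where atoms are evaluated as at ω₀ and agent i believes what
-- i believes at ω⃗ i.
module Extension {n : ℕ} {Φ : Set p} (M : ProbabilityModel n Φ c s)
                 (ω₀ : Carrier (ProbabilityModel.Ω M)) (ω⃗ : Fin n → Carrier (ProbabilityModel.Ω M)) where

  open ProbabilityModel M
  private module Ω = MeasurableSpace Ω

  Ω⁺ : MeasurableSpace c s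
  Ω⁺ = record
    { Carrier    = Maybe Ω.Carrier
    ; 𝓢          = λ A → just ⊢ A ∈ 𝓢 Ω
    ; isσAlgebra = record
      { resp  = λ (f , g) → Ω.resp ((λ {ω} → f {just ω}) , λ {ω} → g {just ω})
      ; whole = Ω.whole
      ; compl = Ω.compl
      ; inter = Ω.inter
      ; union = Ω.union
      }
    }

  source : Fin n → Maybe Ω.Carrier → Ω.Carrier
  source i = fromMaybe (ω⃗ i)

  Pr⁺ : Fin n → Maybe Ω.Carrier → ProbabilityMeasure Ω⁺
  Pr⁺ i w = pushforward just id (Pr i (source i w))

  M⁺ : ProbabilityModel n Φ c s
  M⁺ = record
    { frame = record
      { Ω             = Ω⁺
      ; Pr            = Pr⁺
      ; Pr-measurable = λ i → generated-measurable {Y = Ω} {f = λ ω → Pr⁺ i (just ω)}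
          λ (θ , E , 0≤θ , θ≤1 , (f , g)) →
          Ω.resp ((λ {ω} → g {Pr⁺ i (just ω)}) , λ {ω} → f {Pr⁺ i (just ω)})
            (Pr-measurable i (base (θ , preimage just id E , 0≤θ , θ≤1 , id , id)))
      ; introspective = λ i w → let lowerBound , greatest = introspective i (source i w) in
            (λ { (E , ⊆E , refl) → lowerBound
                   (preimage just id E , (λ eq → ⊆E λ F → eq (preimage just id F)) , refl) })
          , λ u≤ → ≤-trans (u≤ (wholeᴱ Ω⁺ , (λ _ → tt) , refl)) (proj₁ (total (Pr⁺ i w)))
      }
    ; π = λ q → event (fromMaybe ω₀ ⊢ set (π q)) (measurable (π q))
    }

  module _ {Θ : CountableDenseSubset} where

    just-⇔ : (φ : Formula n Φ Θ) → (just ⊢ set (M⁺ ⟦ φ ⟧)) ≐ set (M ⟦ φ ⟧)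
    just-⇔ (atom q)  = id , id
    just-⇔ (¬′ φ)    = let f , g = just-⇔ φ in (_∘ g) , (_∘ f)
    just-⇔ (φ ∧′ ψ)  =
      let f , g = just-⇔ φ
          h , k = just-⇔ ψ
      in (λ (x , y) → f x , h y) , λ (x , y) → g x , k y
    just-⇔ (B i _ φ) =
        (λ {ω} θ≤ → ≤-trans θ≤ (proj₁ (prob-≐ (Pr i ω) _ _ (just-⇔ φ))))
      , (λ {ω} θ≤ → ≤-trans θ≤ (proj₂ (prob-≐ (Pr i ω) _ _ (just-⇔ φ))))

    propositional-⇔ : ∀ (φ : Formula n Φ Θ) → Propositional φ →
                      (nothing ∈ set (M⁺ ⟦ φ ⟧)) ⇔ (ω₀ ∈ set (M ⟦ φ ⟧))
    propositional-⇔ (atom q)  _         = mk⇔ id id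
    propositional-⇔ (¬′ φ)    pφ        = let open Equivalence (propositional-⇔ φ pφ) in mk⇔ (_∘ from) (_∘ to)
    propositional-⇔ (φ ∧′ ψ)  (pφ , pψ) =
      let module L = Equivalence (propositional-⇔ φ pφ)
          module R = Equivalence (propositional-⇔ ψ pψ)
      in mk⇔ (λ (x , y) → L.to x , R.to y) λ (x , y) → L.from x , R.from y

    beliefs-⇔ : ∀ i (φ : Formula n Φ Θ) → BeliefsOf i φ →
                (nothing ∈ set (M⁺ ⟦ φ ⟧)) ⇔ (ω⃗ i ∈ set (M ⟦ φ ⟧))
    beliefs-⇔ i (¬′ φ)    bφ        = let open Equivalence (beliefs-⇔ i φ bφ) in mk⇔ (_∘ from) (_∘ to)
    beliefs-⇔ i (φ ∧′ ψ)  (bφ , bψ) =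
      let module L = Equivalence (beliefs-⇔ i φ bφ)
          module R = Equivalence (beliefs-⇔ i ψ bψ)
      in mk⇔ (λ (x , y) → L.to x , R.to y) λ (x , y) → L.from x , R.from y
    beliefs-⇔ i (B i _ φ) refl      = mk⇔
      (λ θ≤ → ≤-trans θ≤ (proj₁ (prob-≐ (Pr i (ω⃗ i)) _ _ (just-⇔ φ))))
      (λ θ≤ → ≤-trans θ≤ (proj₂ (prob-≐ (Pr i (ω⃗ i)) _ _ (just-⇔ φ))))

-- Excluded middle is what makes the theory of a world complete, hence a description.
module Construction (em : ∀ {ℓ} → ExcludedMiddle ℓ) {n : ℕ} {Φ : Set p} (Θ : CountableDenseSubset)
                    (M : ProbabilityModel n Φ c s) where

  open ProbabilityModel M

  private
    𝓛 : Set (suc 0ℓ ⊔ p)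
    𝓛 = Formula n Φ Θ

  description : Carrier Ω → Pred 𝓛 0ℓ
  description ω φ = ω ∈ set (M ⟦ φ ⟧)

  d₀ : Carrier Ω → Pred 𝓛 0ℓ
  d₀ ω = Propositional ∩ description ω

  dᵢ : Fin n → Carrier Ω → Pred 𝓛 0ℓ
  dᵢ i ω = BeliefsOf i ∩ description ω

  -- Image d is {d(ω) : ω ∈ Ω}. Its elements carry a witness ω, so one set of formulas may be
  -- represented more than once. The generating events E only depend on the set of formulas.
  Image : (Carrier Ω → Pred 𝓛 0ℓ) → Set (suc 0ℓ ⊔ p ⊔ c)
  Image d = Σ[ S ∈ Pred 𝓛 0ℓ ] ∃[ ω ] S ≐ d ω

  inImage : (d : Carrier Ω → Pred 𝓛 0ℓ) → Carrier Ω → Image d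
  inImage d ω = d ω , ω , id , id

  E : (d : Carrier Ω → Pred 𝓛 0ℓ) → 𝓛 → Pred (Image d) 0ℓ
  E d φ (S , _) = φ ∈ S

  space : (Carrier Ω → Pred 𝓛 0ℓ) → MeasurableSpace (suc 0ℓ ⊔ p ⊔ c) (suc 0ℓ ⊔ p ⊔ c)
  space d = generatedBy λ A → ∃[ φ ] A ≡ E d φ

  X : MeasurableSpace (suc 0ℓ ⊔ p ⊔ c) (suc 0ℓ ⊔ p ⊔ c)
  X = space d₀

  T : Fin n → MeasurableSpace (suc 0ℓ ⊔ p ⊔ c) (suc 0ℓ ⊔ p ⊔ c)
  T i = space (dᵢ i)

  d̂₀ : Carrier Ω → Carrier X
  d̂₀ = inImage d₀

  d̂ : Carrier Ω → ∀ i → Carrier (T i)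
  d̂ ω i = inImage (dᵢ i) ω

  IsDescriptionOf : Carrier X → (∀ i → Carrier (T i)) → Pred 𝓛 0ℓ → Set _
  IsDescriptionOf (S₀ , _) t D = IsDescription c s D × S₀ ⊆ D × (∀ i → proj₁ (t i) ⊆ D)

  module _ (x : Carrier X) (t : ∀ i → Carrier (T i))
           {D : Pred 𝓛 0ℓ} (D-description : IsDescriptionOf x t D) where
    private
      M′ = proj₁ (proj₁ (proj₁ D-description))
      ω′ = proj₁ (proj₂ (proj₁ (proj₁ D-description)))
      sound : ∀ {φ} → φ ∈ D → ω′ ∈ set (M′ ⟦ φ ⟧)
      sound = proj₂ (proj₂ (proj₁ (proj₁ D-description)))
      complete = proj₂ (proj₁ D-description)

      decided : ∀ φ → ω′ ∈ set (M′ ⟦ φ ⟧) → φ ∈ D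
      decided φ true with complete φ
      ... | inj₁ φ∈D  = φ∈D
      ... | inj₂ ¬φ∈D = contradiction true (sound ¬φ∈D)

    D-¬ : ∀ φ → (¬′ φ ∈ D) ⇔ (φ ∉ D)
    D-¬ φ = mk⇔ (λ ¬φ∈D φ∈D → sound ¬φ∈D (sound φ∈D)) λ φ∉D →
      [ (λ φ∈D → contradiction φ∈D φ∉D) , id ]′ (complete φ)

    D-∧ : ∀ φ ψ → (φ ∧′ ψ ∈ D) ⇔ (φ ∈ D × ψ ∈ D)
    D-∧ φ ψ = mk⇔ (λ φψ∈D → decided φ (proj₁ (sound φψ∈D)) , decided ψ (proj₂ (sound φψ∈D)))
                  λ (φ∈D , ψ∈D) → decided (φ ∧′ ψ) (sound φ∈D , sound ψ∈D)

    D-propositional : ∀ φ → Propositional φ → (φ ∈ D) ⇔ (φ ∈ proj₁ x)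
    D-propositional φ pφ = mk⇔ to (proj₁ (proj₂ D-description))
      where
      S≐ = proj₂ (proj₂ x)
      to : φ ∈ D → φ ∈ proj₁ x
      to φ∈D with em {P = proj₁ (proj₂ x) ∈ set (M ⟦ φ ⟧)}
      ... | yes true = proj₂ S≐ (pφ , true)
      ... | no false = contradiction φ∈D
        (Equivalence.to (D-¬ φ) (proj₁ (proj₂ D-description) (proj₂ S≐ {¬′ φ} (pφ , false))))

    D-beliefs : ∀ i φ → BeliefsOf i φ → (φ ∈ D) ⇔ (φ ∈ proj₁ (t i))
    D-beliefs i φ bφ = mk⇔ to (proj₂ (proj₂ D-description) i)
      where
      S≐ = proj₂ (proj₂ (t i))
      to : φ ∈ D → φ ∈ proj₁ (t i)
      to φ∈D with em {P = proj₁ (proj₂ (t i)) ∈ set (M ⟦ φ ⟧)}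
      ... | yes true = proj₂ S≐ (bφ , true)
      ... | no false = contradiction φ∈D
        (Equivalence.to (D-¬ φ) (proj₂ (proj₂ D-description) i (proj₂ S≐ {¬′ φ} (bφ , false))))

  description-unique : ∀ x t {D D′} → IsDescriptionOf x t D → IsDescriptionOf x t D′ → D ⊆ D′
  description-unique x t {D} {D′} h h′ {φ} = proj₁ (go φ)
    where
    open Equivalence
    go : ∀ φ → (φ ∈ D → φ ∈ D′) × (φ ∈ D′ → φ ∈ D)
    go (atom q)    = from (D-propositional x t h′ (atom q) tt) ∘ to (D-propositional x t h (atom q) tt)
                   , from (D-propositional x t h (atom q) tt) ∘ to (D-propositional x t h′ (atom q) tt)
    go (¬′ φ)      = (λ m → from (D-¬ x t h′ φ) (to (D-¬ x t h φ) m ∘ proj₂ (go φ)))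
                   , (λ m → from (D-¬ x t h φ) (to (D-¬ x t h′ φ) m ∘ proj₁ (go φ)))
    go (φ ∧′ ψ)    = (λ m → let a , b = to (D-∧ x t h φ ψ) m
                            in from (D-∧ x t h′ φ ψ) (proj₁ (go φ) a , proj₁ (go ψ) b))
                   , (λ m → let a , b = to (D-∧ x t h′ φ ψ) m
                            in from (D-∧ x t h φ ψ) (proj₂ (go φ) a , proj₂ (go ψ) b))
    go (B i θ φ)   = from (D-beliefs x t h′ i (B i θ φ) refl) ∘ to (D-beliefs x t h i (B i θ φ) refl)
                   , from (D-beliefs x t h i (B i θ φ) refl) ∘ to (D-beliefs x t h′ i (B i θ φ) refl)

  -- D and β are only known through the properties that determine them.
  abstract
    ∃!-description : ∀ x t → ∃! _≐_ (IsDescriptionOf x t)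
    ∃!-description x@(S₀ , ω₀ , S₀≐) t =
        D
      , h
      , λ h′ → description-unique x t h h′ , description-unique x t h′ h
      where
      open Extension M ω₀ (λ i → proj₁ (proj₂ (t i)))
      D : Pred 𝓛 0ℓ
      D φ = nothing ∈ set (M⁺ ⟦ φ ⟧)
      complete : ∀ φ → φ ∈ D ⊎ ¬′ φ ∈ D
      complete φ with em {P = φ ∈ D}
      ... | yes φ∈D = inj₁ φ∈D
      ... | no  φ∉D = inj₂ φ∉D
      h : IsDescriptionOf x t D
      h = ((M⁺ , nothing , id) , complete)
        , (λ {φ} φ∈S₀ → let pφ , true = proj₁ S₀≐ φ∈S₀ in Equivalence.from (propositional-⇔ φ pφ) true)
        , (λ i {φ} φ∈Sᵢ → let bφ , true = proj₁ (proj₂ (proj₂ (t i))) φ∈Sᵢ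
                        in Equivalence.from (beliefs-⇔ i φ bφ) true)

  D : Carrier X → (∀ i → Carrier (T i)) → Pred 𝓛 0ℓ
  D x t = proj₁ (∃!-description x t)

  D-isDescription : ∀ x t → IsDescriptionOf x t (D x t)
  D-isDescription x t = proj₁ (proj₂ (∃!-description x t))

  ⟨_⟩ : 𝓛 → Pred (Carrier (Product X T)) 0ℓ
  ⟨ φ ⟩ (x , t) = φ ∈ D x t

  ⟨⟩-measurable : ∀ φ → ⟨ φ ⟩ ∈ 𝓢 (Product X T)
  ⟨⟩-measurable (atom q)  = resp ((λ {(x , t)} → from (D-atom x t)) , λ {(x , t)} → to (D-atom x t))
      (base (cyl₀ (base (atom q , refl))))
    where
    open Equivalence
    D-atom = λ x t → D-propositional x t (D-isDescription x t) (atom q) tt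
  ⟨⟩-measurable (¬′ φ)    = resp ((λ {(x , t)} → from (D-neg x t)) , λ {(x , t)} → to (D-neg x t))
      (compl (⟨⟩-measurable φ))
    where
    open Equivalence
    D-neg = λ x t → D-¬ x t (D-isDescription x t) φ
  ⟨⟩-measurable (φ ∧′ ψ)  = resp ((λ {(x , t)} → from (D-and x t)) , λ {(x , t)} → to (D-and x t))
      (inter (⟨⟩-measurable φ) (⟨⟩-measurable ψ))
    where
    open Equivalence
    D-and = λ x t → D-∧ x t (D-isDescription x t) φ ψ
  ⟨⟩-measurable (B i θ φ) = resp ((λ {(x , t)} → from (D-B x t)) , λ {(x , t)} → to (D-B x t))
      (base (cylᵢ i (base (B i θ φ , refl))))
    where
    open Equivalence
    D-B = λ x t → D-beliefs x t (D-isDescription x t) i (B i θ φ) refl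

  [_] : 𝓛 → Event (Product X T)
  [ φ ] = event ⟨ φ ⟩ (⟨⟩-measurable φ)

  IsBelief : ∀ i → Carrier (T i) → ProbabilityMeasure (Product X T) → Set _
  IsBelief i (S , _) μ = ∀ φ θ → (proj₁ θ ≤ prob μ [ φ ]) ⇔ (B i θ φ ∈ S)

  embed : Carrier Ω → Carrier (Product X T)
  embed ω = d̂₀ ω , d̂ ω

  private module Ω = MeasurableSpace Ω

  ∩-constant : (P : Set) (F : Event Ω) → (λ ω → P × ω ∈ set F) ∈ 𝓢 Ω
  ∩-constant P F with em {P = P}
  ... | yes p = Ω.resp ((p ,_) , proj₂) (measurable F)
  ... | no ¬p = Ω.resp ((λ ()) , ¬p ∘ proj₁) (measurable (emptyᴱ Ω))

  embed-measurable : Measurable Ω (Product X T) embed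
  embed-measurable = generated-measurable {Y = Ω} λ
    { (cyl₀ A∈𝓢)   → generated-measurable {Y = Ω} {f = d̂₀}
          (λ { (φ , refl) → ∩-constant (Propositional φ) (M ⟦ φ ⟧) }) A∈𝓢
    ; (cylᵢ i A∈𝓢) → generated-measurable {Y = Ω} {f = λ ω → d̂ ω i}
          (λ { (φ , refl) → ∩-constant (BeliefsOf i φ) (M ⟦ φ ⟧) }) A∈𝓢
    }

  description-isDescription : ∀ ω → IsDescriptionOf (d̂₀ ω) (d̂ ω) (description ω)
  description-isDescription ω = ((M , ω , id) , complete) , proj₂ , λ i → proj₂
    where
    complete : ∀ φ → φ ∈ description ω ⊎ ¬′ φ ∈ description ω
    complete φ with em {P = φ ∈ description ω}
    ... | yes true = inj₁ true
    ... | no false = inj₂ false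

  embed-[] : ∀ φ → (embed ⊢ ⟨ φ ⟩) ≐ set (M ⟦ φ ⟧)
  embed-[] φ =
      (λ {ω} → description-unique (d̂₀ ω) (d̂ ω) (D-isDescription (d̂₀ ω) (d̂ ω))
                (description-isDescription ω) {φ})
    , (λ {ω} → description-unique (d̂₀ ω) (d̂ ω) (description-isDescription ω)
                (D-isDescription (d̂₀ ω) (d̂ ω)) {φ})

  Truths : Pred (Pred (Carrier (Product X T)) 0ℓ) _
  Truths A = ∃[ φ ] A ≐ ⟨ φ ⟩

  ∩-closed : ∀ {A A′} → A ∈ Truths → A′ ∈ Truths → A ∩ A′ ∈ Truths
  ∩-closed (φ , f , g) (ψ , h , k) = φ ∧′ ψ
    , (λ {(x , t)} (a , b) → Equivalence.from (D-∧ x t (D-isDescription x t) φ ψ) (f a , h b))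
    , (λ {(x , t)} ab → let a , b = Equivalence.to (D-∧ x t (D-isDescription x t) φ ψ) ab in g a , k b)

  Product⊆Truths : 𝓢 (Product X T) ⊆ Generated Truths
  Product⊆Truths = generated-measurable {Y = generatedBy Truths} {f = id} λ
    { (cyl₀ A∈𝓢)   → generated-measurable {Y = generatedBy Truths} {f = proj₁}
          (λ { (φ , refl) → cyl₀∈ φ }) A∈𝓢
    ; (cylᵢ i A∈𝓢) → generated-measurable {Y = generatedBy Truths} {f = λ (_ , t) → t i}
          (λ { (φ , refl) → cylᵢ∈ i φ }) A∈𝓢
    }
    where
    open Equivalence
    empty∈ : ∀ {A} → A ⊆ ∅ → Generated Truths A
    empty∈ A⊆∅ = resp ((λ y∉U → ⊥-elim (y∉U tt)) , λ a → ⊥-elim (A⊆∅ a)) (compl whole)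
    cyl₀∈ : ∀ φ → Generated Truths (proj₁ ⊢ E d₀ φ)
    cyl₀∈ φ with em {P = Propositional φ}
    ... | yes pφ = base (φ , (λ {(x , t)} → from (D-propositional x t (D-isDescription x t) φ pφ))
                          , (λ {(x , t)} → to (D-propositional x t (D-isDescription x t) φ pφ)))
    ... | no ¬pφ = empty∈ λ {((_ , _ , S≐) , _)} φ∈S → ¬pφ (proj₁ (proj₁ S≐ φ∈S))
    cylᵢ∈ : ∀ i φ → Generated Truths ((λ (_ , t) → t i) ⊢ E (dᵢ i) φ)
    cylᵢ∈ i φ with em {P = BeliefsOf i φ}
    ... | yes bφ = base (φ , (λ {(x , t)} → from (D-beliefs x t (D-isDescription x t) i φ bφ))
                          , (λ {(x , t)} → to (D-beliefs x t (D-isDescription x t) i φ bφ)))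
    ... | no ¬bφ = empty∈ λ {(_ , t)} φ∈S → ¬bφ (proj₁ (proj₁ (proj₂ (proj₂ (t i))) φ∈S))

  belief-unique : ∀ i t μ ν → IsBelief i t μ → IsBelief i t ν → μ ≈ₘ ν
  belief-unique i t μ ν hμ hν = measure-unique em ∩-closed Product⊆Truths μ ν λ (φ , A≐⟨φ⟩) →
      resp (proj₂ A≐⟨φ⟩ , proj₁ A≐⟨φ⟩) (⟨⟩-measurable φ)
    , ≈-trans (prob-≐ μ _ [ φ ] A≐⟨φ⟩) (≈-trans
          (below μ ν hμ hν φ , below ν μ hν hμ φ) (≈-sym (prob-≐ ν _ [ φ ] A≐⟨φ⟩)))
    where
    below : ∀ μ ν → IsBelief i t μ → IsBelief i t ν → ∀ φ → prob μ [ φ ] ≤ prob ν [ φ ]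
    below μ ν hμ hν φ = ≤-from-thresholds em Θ (prob≤1 em μ [ φ ]) (nonneg ν [ φ ]) λ {θ} θ∈Θ →
      Equivalence.from (hν φ (θ , θ∈Θ)) ∘ Equivalence.to (hμ φ (θ , θ∈Θ))

  abstract
    ∃!-belief : ∀ i t → ∃! _≈ₘ_ (IsBelief i t)
    ∃!-belief i t@(S , ω , S≐) = μ , isBelief , λ {ν} → belief-unique i t μ ν isBelief
      where
      μ : ProbabilityMeasure (Product X T)
      μ = pushforward embed embed-measurable (Pr i ω)
      isBelief : IsBelief i t μ
      isBelief φ θ =
        let eq = prob-≐ (Pr i ω) (preimage embed embed-measurable [ φ ]) (M ⟦ φ ⟧) (embed-[] φ)
        in mk⇔ (λ θ≤ → proj₂ S≐ (refl , ≤-trans θ≤ (proj₁ eq)))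
               (λ B∈S → ≤-trans (proj₂ (proj₁ S≐ B∈S)) (proj₂ eq))

  β : ∀ i → Carrier (T i) → ProbabilityMeasure (Product X T)
  β i t = proj₁ (∃!-belief i t)

  𝒯 : TypeStructure n (suc 0ℓ ⊔ p ⊔ c) (suc 0ℓ ⊔ p ⊔ c)
  𝒯 = record { X = X ; T = T ; β = β }

  E₀ : 𝓛 → Pred (Carrier X) 0ℓ
  E₀ = E d₀

  ℐ : IsTypeSpace 𝒯 → (∀ q → E₀ (atom q) ∈ 𝓢 X) → InterpretedTypeSpace n Φ _ _
  ℐ isTypeSpace E₀∈𝓢 = record
    { typeStructure = 𝒯
    ; isTypeSpace   = isTypeSpace
    ; ν             = λ q → event (E₀ (atom q)) (E₀∈𝓢 q)
    }

{-# OPTIONS --safe #-}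

-- Truth in ℐ_M is membership in the description: ⟦φ⟧ᴵ = [φ] by induction on φ, the case of B being
-- the property that defines β. For measurability of β, the events E such that t ↦ β i t (E) is
-- measurable form a Dynkin class that contains the sets [φ]; these are closed under ∩ and generate
-- the product. For the marginals, β i (dᵢ ω) is the image of Pr i ω under ω′ ↦ (d₀ ω′ , d ω′), and
-- agent i's formulas have the same truth values at all ω′ with Pr i ω′ = Pr i ω, which have outer
-- measure 1.
module Submission where

open import Axiom.ExcludedMiddle using (ExcludedMiddle)
open import Data.Empty using (⊥-elim)
open import Data.Integer as ℤ using (+_)
open import Data.Nat using (ℕ; zero; suc)
open import Data.Product using (_×_; _,_; ∃-syntax; Σ-syntax; proj₁; proj₂)
open import Data.Rational as ℚ using (ℚ; 0ℚ; 1ℚ)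
import Data.Rational.Properties as ℚ
open import Data.Rational.Solver using (module +-*-Solver)
open import Data.Unit using (tt)
open import Function using (_∘_; id; _⇔_; mk⇔; Equivalence)
open import Level using (Level; 0ℓ)
open import Relation.Binary.PropositionalEquality using (_≡_; refl; sym; trans; cong; subst)
open import Relation.Nullary using (yes; no; decidable-stable)
open import Relation.Unary using (Pred; _∈_; _∉_; _⊆_; _≐_; _∩_; ⋃; ⋂)
open import Defs

private
  variable
    a c g p s : Level

-- Measurability of real-valued functions

difference : ∀ i → ∃[ m ] ∃[ n ] i ≡ m ℤ.⊖ n
difference (+ m)      = m , 0 , refl
difference ℤ.-[1+ n ] = 0 , suc n , refl

module _ (em : ∀ {ℓ} → ExcludedMiddle ℓ) where

  module _ (Y : MeasurableSpace c s) where
    private module Y = MeasurableSpace Y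

    -- Lets side conditions that do not depend on the point appear inside countable unions and
    -- intersections of events.
    const∈𝓢 : (P : Set) → (λ _ → P) ∈ Y.𝓢
    const∈𝓢 P with em {P = P}
    ... | yes p = Y.resp ((λ _ → p) , λ _ → tt) Y.whole
    ... | no ¬p = Y.resp ((λ y∉U → ⊥-elim (y∉U tt)) , λ p → ⊥-elim (¬p p)) (Y.compl Y.whole)

    -- A union over ℚ is a threefold union over ℕ, indexed by the fractions (m - n) / (1 + d).
    ⋃ℚ∈𝓢 : {A : ℚ → Pred Y.Carrier 0ℓ} → (∀ q → A q ∈ Y.𝓢) → ⋃ ℚ A ∈ Y.𝓢
    ⋃ℚ∈𝓢 {A} A∈𝓢 = Y.resp
      ( (λ (m , n , d , y∈A) → (m ℤ.⊖ n) ℚ./ suc d , y∈A)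
      , λ { (q , y∈A) → let m , n , ↥q≡m-n = difference (ℚ.↥ q) in
              m , n , ℚ.denominator-1 q
            , subst (λ r → _ ∈ A r) (trans (sym (ℚ.↥p/↧p≡p q)) (cong (ℚ._/ ℚ.↧ₙ q) ↥q≡m-n)) y∈A } )
      (Y.union λ m → Y.union λ n → Y.union λ d → A∈𝓢 ((m ℤ.⊖ n) ℚ./ suc d))

    ⋂ℚ∈𝓢 : {A : ℚ → Pred Y.Carrier 0ℓ} → (∀ q → A q ∈ Y.𝓢) → ⋂ ℚ A ∈ Y.𝓢
    ⋂ℚ∈𝓢 A∈𝓢 = Y.resp
      ( (λ none q → decidable-stable em λ y∉A → none (q , y∉A))
      , λ all (q , y∉A) → y∉A (all q) )
      (Y.compl (⋃ℚ∈𝓢 (Y.compl ∘ A∈𝓢)))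

    -- `q ∈ cut (f y)` says `q` < `f y`, so these are the preimages of the open rays above
    -- rationals.
    MeasurableFunction : Pred (Y.Carrier → ℝ) _
    MeasurableFunction f = ∀ q → (λ y → q ∈ cut (f y)) ∈ Y.𝓢

    ≈-measurable : ∀ {f g} → (∀ y → f y ≈ g y) → MeasurableFunction f → MeasurableFunction g
    ≈-measurable f≈g mf q = Y.resp ((λ {y} → ≤⁻ (proj₁ (f≈g y))) , λ {y} → ≤⁻ (proj₂ (f≈g y))) (mf q)

    const-measurable : ∀ x → MeasurableFunction (λ _ → x)
    const-measurable x q = const∈𝓢 (q ∈ cut x)

    +-measurable : ∀ {f g} → MeasurableFunction f → MeasurableFunction g → MeasurableFunction (λ y → f y + g y)
    +-measurable mf mg q = ⋃ℚ∈𝓢 λ a → ⋃ℚ∈𝓢 λ b → Y.inter (mf a) (Y.inter (mg b) (const∈𝓢 (q ℚ.≤ a ℚ.+ b)))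

    partialSum-measurable : ∀ {f : ℕ → Y.Carrier → ℝ} → (∀ k → MeasurableFunction (f k)) →
                            ∀ k → MeasurableFunction (λ y → partialSum (λ j → f j y) k)
    partialSum-measurable mf zero    = const-measurable 0ℝ
    partialSum-measurable {f} mf (suc k) =
      +-measurable {λ y → partialSum (λ j → f j y) k} {f k} (partialSum-measurable {f} mf k) (mf k)

    series-measurable : ∀ {f : ℕ → Y.Carrier → ℝ} {g} → (∀ k → MeasurableFunction (f k)) →
                        (∀ y → (λ k → f k y) SumsTo g y) → MeasurableFunction g
    series-measurable {f} {g} mf sums q = Y.resp
      ( (λ {y} (k , q∈) → ≤⁻ (proj₁ (sums y) (k , refl)) q∈)
      -- If `q` is below no partial sum, then `fromℚ q` bounds them all and hence bounds `g y`,
      -- against `q∈g`.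
      , λ {y} q∈g → decidable-stable em λ none → ℚ.<-irrefl refl
          (≤⁻ (proj₂ (sums y) {fromℚ q} λ { (k , refl) → ≤⁺ λ r∈ →
                ∉⇒> (partialSum (λ j → f j y) k) r∈ λ q∈ → none (k , q∈) })
              q∈g) )
      (Y.union λ k → partialSum-measurable {f} mf k q)

    private
      open +-*-Solver using (solve; _:=_; _:+_; _:-_; con)

      [1-r]+r≡1 : ∀ r → (1ℚ ℚ.- r) ℚ.+ r ≡ 1ℚ
      [1-r]+r≡1 = solve 1 (λ r → (con 1ℚ :- r) :+ r := con 1ℚ) refl

    -- If f + g = 1, then q < g iff f ≤ 1 - r for some r > q.
    complement-measurable : ∀ {f g} → (∀ y → f y + g y ≈ 1ℝ) → MeasurableFunction f → MeasurableFunction g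
    complement-measurable {f} {g} f+g≈1 mf q = Y.resp (to , from)
      (⋃ℚ∈𝓢 λ r → Y.inter (const∈𝓢 (q ℚ.< r)) (Y.compl (mf (1ℚ ℚ.- r))))
      where
      to : ⋃ ℚ (λ r y → q ℚ.< r × 1ℚ ℚ.- r ∉ cut (f y)) ⊆ λ y → q ∈ cut (g y)
      to {y} (r , q<r , 1-r∉f) = decidable-stable em λ q∉g →
        -- As (1 - r) + q < 1, it is at most some a + b; but a < 1 - r and b < q.
        let a , b , a∈f , b∈g , s≤a+b = ≤⁻ (proj₂ (f+g≈1 y))
              (subst ((1ℚ ℚ.- r) ℚ.+ q ℚ.<_) ([1-r]+r≡1 r) (ℚ.+-monoʳ-< (1ℚ ℚ.- r) q<r))
        in ℚ.<-irrefl refl (ℚ.≤-<-trans s≤a+b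
             (ℚ.+-mono-< (∉⇒> (f y) a∈f 1-r∉f) (∉⇒> (g y) b∈g q∉g)))
      from : (λ y → q ∈ cut (g y)) ⊆ ⋃ ℚ (λ r y → q ℚ.< r × 1ℚ ℚ.- r ∉ cut (f y))
      from {y} q∈g =
        let r , q<r , r∈g = rounded (g y) q∈g
        in r , q<r , λ 1-r∈f → ℚ.<-irrefl refl
             (≤⁻ (proj₁ (f+g≈1 y)) (_ , r , 1-r∈f , r∈g , ℚ.≤-reflexive (sym ([1-r]+r≡1 r))))

    -- Inclusion of cuts is tested at each rational, which gives a countable intersection.
    ≥-measurable : ∀ {f} → MeasurableFunction f → ∀ x → (λ y → x ≤ f y) ∈ Y.𝓢
    ≥-measurable {f} mf x = Y.resp
      ( (λ {y} all → ≤⁺ λ {q} q∈x → decidable-stable em λ q∉f → all q (q∈x , q∉f))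
      , λ x≤f q (q∈x , q∉f) → q∉f (≤⁻ x≤f q∈x) )
      (⋂ℚ∈𝓢 λ q → Y.compl (Y.inter (const∈𝓢 (q ∈ cut x)) (Y.compl (mf q))))

    -- For q ≥ 0, q < f iff q < θ ≤ f for some θ ∈ Θ.
    thresholds-measurable : (Θ : CountableDenseSubset) → let open CountableDenseSubset Θ in
                            ∀ {f} → (∀ y → 0ℝ ≤ f y) → (∀ y → f y ≤ 1ℝ) →
                            (∀ {θ} → θ ∈ Member → (λ y → θ ≤ f y) ∈ Y.𝓢) → MeasurableFunction f
    thresholds-measurable Θ {f} 0≤f f≤1 mf q with q ℚ.<? 0ℚ
    ... | yes q<0 = Y.resp ((λ {y} _ → ≤⁻ (0≤f y) q<0) , λ _ → tt) Y.whole
    ... | no  q≮0 = Y.resp (to , from)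
      (Y.union λ k → Y.inter (const∈𝓢 (q ∈ cut (e k))) (mf (e∈Θ k)))
      where
      open CountableDenseSubset Θ
      e   = proj₁ countable
      e∈Θ = proj₁ (proj₂ countable)
      enumerates = proj₂ (proj₂ countable)
      to : ⋃ ℕ (λ k y → q ∈ cut (e k) × e k ≤ f y) ⊆ λ y → q ∈ cut (f y)
      to (k , q∈e , e≤f) = ≤⁻ e≤f q∈e
      from : (λ y → q ∈ cut (f y)) ⊆ ⋃ ℕ (λ k y → q ∈ cut (e k) × e k ≤ f y)
      from {y} q∈f =
        let r , q<r , r∈f = rounded (f y) q∈f
            -- Density is applied at `r`, strictly between `q` and `f y`; it lies in [0,1] because
            -- `q` is nonnegative and `f y` is at most 1.
            θ , θ∈Θ , (p , p∈θ , p≮q) , (t , t∈f , t∉θ) = dense {fromℚ r} {fromℚ q} {f y}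
              (≤⁺ λ p<0 → ℚ.<-trans (ℚ.<-≤-trans p<0 (ℚ.≮⇒≥ q≮0)) q<r)
              (≤⁺ λ p<r → ≤⁻ (f≤1 y) (lower (f y) (ℚ.<⇒≤ p<r) r∈f))
              (q , q<r , ℚ.<-irrefl refl)
              (r , r∈f , ℚ.<-irrefl refl)
            k , eₖ≤θ , θ≤eₖ = enumerates θ∈Θ
        in k , ≤⁻ θ≤eₖ (lower θ (ℚ.≮⇒≥ p≮q) p∈θ)
             , ≤-trans eₖ≤θ (≤⁺ λ p∈θ → lower (f y) (ℚ.<⇒≤ (∉⇒> θ p∈θ t∉θ)) t∈f)

  -- Measurability of maps into a space of probability measures

  module _ {Y : MeasurableSpace c s} {Z : MeasurableSpace a p}
           {G : Pred (Pred (MeasurableSpace.Carrier Z) 0ℓ) g}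
           (∩-closed : ∀ {A A′} → A ∈ G → A′ ∈ G → A ∩ A′ ∈ G)
           (𝓢⊆ : MeasurableSpace.𝓢 Z ⊆ Generated G)
           (κ : MeasurableSpace.Carrier Y → ProbabilityMeasure Z)
           (gens : ∀ {A} → A ∈ G → Σ[ A∈𝓢 ∈ A ∈ MeasurableSpace.𝓢 Z ]
                   MeasurableFunction Y (λ y → prob (κ y) (event A A∈𝓢)))
           where

    private
      module Z = MeasurableSpace Z

      Good : Pred (Pred Z.Carrier 0ℓ) _
      Good A = Σ[ A∈𝓢 ∈ A ∈ Z.𝓢 ] MeasurableFunction Y (λ y → prob (κ y) (event A A∈𝓢))

      -- Complements use that the two measures add up to 1, disjoint unions use countable
      -- additivity. Intersections have no such formula, hence the induction over `Dynkin` instead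
      -- of `Generated`.
      good : Dynkin G ⊆ Good
      good (base A∈G) = gens A∈G
      good (resp A≐A′ DA) =
        let A∈𝓢 , mf = good DA
        in Z.resp A≐A′ A∈𝓢 , ≈-measurable Y (λ y → prob-≐ (κ y) _ _ A≐A′) mf
      good whole = Z.whole , ≈-measurable Y (λ y → ≈-sym (total (κ y))) (const-measurable Y 1ℝ)
      good (compl DA) =
        let A∈𝓢 , mf = good DA
        in Z.compl A∈𝓢 , complement-measurable Y (λ y → prob-∁ em (κ y) (event _ A∈𝓢)) mf
      good (dunion disj DA) =
          Z.union (proj₁ ∘ good ∘ DA)
        , series-measurable Y (proj₂ ∘ good ∘ DA)
            λ y → additive (κ y) (λ k → event _ (proj₁ (good (DA k)))) disj

    kernel-measurable : Measurable Y (Δ Z) κ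
    kernel-measurable = generated-measurable {Y = Y} λ { (θ , E , _ , _ , A⊆ , ⊆A) →
      -- `good` comes with its own measurability proof for the set of `E`; `prob-≐` makes the choice
      -- of proof irrelevant.
      let _ , mf = good (Generated⊆Dynkin em ∩-closed (𝓢⊆ (measurable E)))
      in MeasurableSpace.resp Y ((λ {y} → ⊆A {κ y}) , λ {y} → A⊆ {κ y})
           (≥-measurable Y (≈-measurable Y (λ y → prob-≐ (κ y) _ E (id , id)) mf) θ) }

-- Unseparated points and null events

generated-indistinguishable : {Y : Set c} {G : Pred (Pred Y 0ℓ) g} {y y′ : Y} →
                              (∀ {A} → A ∈ G → (y ∈ A) ⇔ (y′ ∈ A)) →
                              ∀ {A} → Generated G A → (y ∈ A) ⇔ (y′ ∈ A)
generated-indistinguishable {G = G} {y} {y′} same = go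
  where
  open Equivalence
  go : ∀ {A} → Generated G A → (y ∈ A) ⇔ (y′ ∈ A)
  go (base A∈G)           = same A∈G
  go (resp (A⊆B , B⊆A) A∈) = mk⇔ (A⊆B ∘ to (go A∈) ∘ B⊆A) (A⊆B ∘ from (go A∈) ∘ B⊆A)
  go whole                = mk⇔ id id
  go (compl A∈)           = mk⇔ (_∘ from (go A∈)) (_∘ to (go A∈))
  go (inter A∈ B∈)        = mk⇔ (λ (a , b) → to (go A∈) a , to (go B∈) b)
                                (λ (a , b) → from (go A∈) a , from (go B∈) b)
  go (union A∈)           = mk⇔ (λ (k , a) → k , to (go (A∈ k)) a) (λ (k , a) → k , from (go (A∈ k)) a)

module _ (em : ∀ {ℓ} → ExcludedMiddle ℓ) {Y : MeasurableSpace c s} (μ : ProbabilityMeasure Y)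
         (E : Event Y) where

  -- From μ(∁E) + μ(E) ≤ 1 + 0, cancel μ(∁E) on the left against the smaller 1 on the right.
  null-complement : 1ℝ ≤ prob μ (∁ᴱ Y E) → prob μ E ≈ 0ℝ
  null-complement 1≤ =
      +-cancel-≤ em 1≤ (≤-trans +-comm-≤ (≤-trans (proj₁ (prob-∁ em μ E)) (x≤x+y ≤-refl)))
    , nonneg μ E

-- The type space of a probability model

module _ (em : ∀ {ℓ} → ExcludedMiddle ℓ) {n : ℕ} {Φ : Set p} (Θ : CountableDenseSubset)
         (M : ProbabilityModel n Φ c s) where

  open ProbabilityModel M using (Ω; Pr; introspective)
  open Construction em Θ M
  open Equivalence
  private
    module Ω = MeasurableSpace Ω
    module X = MeasurableSpace X
    module T i = MeasurableSpace (T i)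

  β-isBelief : ∀ i t → IsBelief i t (β i t)
  β-isBelief i t = proj₁ (proj₂ (∃!-belief i t))

  𝒯-measurable : ∀ i → Measurable (T i) (Δ (Product X T)) (β i)
  𝒯-measurable i = kernel-measurable em {Y = T i} {Z = Product X T} ∩-closed Product⊆Truths (β i)
    λ { {A} (φ , A≐⟨φ⟩@(A⊆ , ⊆A)) → resp (⊆A , A⊆) (⟨⟩-measurable φ)
      , ≈-measurable em (T i) (λ t → ≈-sym (prob-≐ (β i t) _ [ φ ] A≐⟨φ⟩))
          -- The property defining `β` turns {t : θ ≤ β i t [φ]} into the generator
          -- `E (dᵢ i) (B i θ φ)`.
          (thresholds-measurable em (T i) Θ (λ t → nonneg (β i t) [ φ ]) (λ t → prob≤1 em (β i t) [ φ ])
            λ {θ} θ∈Θ → resp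
              ( (λ {t} → from (β-isBelief i t φ (θ , θ∈Θ)))
              , λ {t} → to (β-isBelief i t φ (θ , θ∈Θ)) )
              (base (B i (θ , θ∈Θ) φ , refl))) }

  -- `β` is abstract and does not unfold to this measure; `belief-unique` identifies the two.
  image-belief : ∀ i → T.Carrier i → ProbabilityMeasure (Product X T)
  image-belief i (_ , ω , _) = pushforward embed embed-measurable (Pr i ω)

  image-isBelief : ∀ i t → IsBelief i t (image-belief i t)
  image-isBelief i (S , ω , S⊆ , ⊆S) φ θ =
    let eq = prob-≐ (Pr i ω) (preimage embed embed-measurable [ φ ]) (M ⟦ φ ⟧) (embed-[] φ)
    in mk⇔ (λ θ≤ → ⊆S (refl , ≤-trans θ≤ (proj₁ eq))) (λ B∈S → ≤-trans (proj₂ (S⊆ B∈S)) (proj₂ eq))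

  beliefs-determined : ∀ i {ω ω′} → Pr i ω ≈ₘ Pr i ω′ → ∀ (φ : Formula n Φ Θ) → BeliefsOf i φ →
                       (ω ∈ set (M ⟦ φ ⟧)) ⇔ (ω′ ∈ set (M ⟦ φ ⟧))
  beliefs-determined i eq (¬′ φ) bφ =
    let ih = beliefs-determined i eq φ bφ in mk⇔ (_∘ from ih) (_∘ to ih)
  beliefs-determined i eq (φ ∧′ ψ) (bφ , bψ) =
    let ihφ = beliefs-determined i eq φ bφ
        ihψ = beliefs-determined i eq ψ bψ
    in mk⇔ (λ (x , y) → to ihφ x , to ihψ y) (λ (x , y) → from ihφ x , from ihψ y)
  beliefs-determined i eq (B .i θ φ) refl =
    mk⇔ (λ θ≤ → ≤-trans θ≤ (proj₁ (eq (M ⟦ φ ⟧)))) (λ θ≤ → ≤-trans θ≤ (proj₂ (eq (M ⟦ φ ⟧))))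

  -- It suffices to compare the generators `E (dᵢ i) φ`. If `φ` is not a Boolean combination of
  -- beliefs of `i`, its generator contains neither point.
  same-beliefs-same-events : ∀ i (t : T.Carrier i) {ω} → Pr i ω ≈ₘ Pr i (proj₁ (proj₂ t)) →
                             ∀ {A} → A ∈ T.𝓢 i → (d̂ ω i ∈ A) ⇔ (t ∈ A)
  same-beliefs-same-events i (S , ω₀ , S⊆ , ⊆S) eq = generated-indistinguishable λ { (φ , refl) → mk⇔
    (λ (bφ , true) → ⊆S (bφ , to (beliefs-determined i eq φ bφ) true))
    (λ φ∈S → let bφ , true = S⊆ φ∈S in bφ , from (beliefs-determined i eq φ bφ) true) }

  marginal-certain : ∀ i t (F : Event (T i)) → t ∈ set F → 1ℝ ≤ prob (marginal X T i (β i t)) F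
  marginal-certain i t F t∈F = ≤-trans
    (proj₁ (introspective i (proj₁ (proj₂ t)))
      -- The event left to unification is the preimage of `F` under `embed` followed by the
      -- projection to `T i`; it contains every world where `i` has the same measure.
      (_ , (λ eq → from (same-beliefs-same-events i t eq (measurable F)) t∈F) , refl))
    (proj₁ (belief-unique i t (image-belief i t) (β i t) (image-isBelief i t) (β-isBelief i t)
      (preimage (λ (_ , t) → t i) (λ A∈𝓢 → base (cylᵢ i A∈𝓢)) F)))

  𝒯-marginal : ∀ i t → IsDirac t (marginal X T i (β i t))
  𝒯-marginal i t F =
      (λ t∈F → prob≤1 em μ F , marginal-certain i t F t∈F)
    , (λ t∉F → null-complement em μ F (marginal-certain i t (∁ᴱ (T i) F) t∉F))
    where μ = marginal X T i (β i t)

  𝒯-isTypeSpace : IsTypeSpace 𝒯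
  𝒯-isTypeSpace = record { β-measurable = 𝒯-measurable ; β-marginal = 𝒯-marginal }

  E₀-measurable : ∀ φ → E₀ φ ∈ X.𝓢
  E₀-measurable φ = base (φ , refl)

  -- Both inclusions are proved together: negation exchanges them, and belief needs the two sets to
  -- have equal measure.
  truth-sets : ∀ φ → set (ℐ 𝒯-isTypeSpace (E₀-measurable ∘ atom) ⟦ φ ⟧ᴵ) ≐ ⟨ φ ⟩
  truth-sets (atom q) =
      (λ {(x , t)} → from (D-propositional x t (D-isDescription x t) (atom q) tt))
    , (λ {(x , t)} → to (D-propositional x t (D-isDescription x t) (atom q) tt))
  truth-sets (¬′ φ) =
      (λ {(x , t)} φ∉ → from (D-¬ x t (D-isDescription x t) φ) (φ∉ ∘ proj₂ (truth-sets φ)))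
    , (λ {(x , t)} ¬φ∈ → to (D-¬ x t (D-isDescription x t) φ) ¬φ∈ ∘ proj₁ (truth-sets φ))
  truth-sets (φ ∧′ ψ) =
      (λ {(x , t)} (a , b) →
        from (D-∧ x t (D-isDescription x t) φ ψ) (proj₁ (truth-sets φ) a , proj₁ (truth-sets ψ) b))
    , (λ {(x , t)} ab →
        let a , b = to (D-∧ x t (D-isDescription x t) φ ψ) ab
        in proj₂ (truth-sets φ) a , proj₂ (truth-sets ψ) b)
  truth-sets (B i θ φ) =
      (λ {(x , t)} θ≤ → from (inD x t) (to (β-isBelief i (t i) φ θ) (≤-trans θ≤ (proj₁ (same t)))))
    , (λ {(x , t)} B∈D → ≤-trans (from (β-isBelief i (t i) φ θ) (to (inD x t) B∈D)) (proj₂ (same t)))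
    where
    inD = λ x t → D-beliefs x t (D-isDescription x t) i (B i θ φ) refl
    same = λ (t : ∀ i → T.Carrier i) → prob-≐ (β i (t i)) _ [ φ ] (truth-sets φ)

proposition7 : ∀ {p c s} (em : ∀ {ℓ} → ExcludedMiddle ℓ)
                   {n : ℕ} {Φ : Set p} (Θ : CountableDenseSubset) (M : ProbabilityModel n Φ c s) →
                 let open ProbabilityModel M using (Ω)
                     open Construction em Θ M
                 in
                 Σ[ isTypeSpace ∈ IsTypeSpace 𝒯 ]
                 Σ[ E₀∈𝓢 ∈ (∀ q → E₀ (atom q) ∈ MeasurableSpace.𝓢 X) ]
                 (∀ (φ : Formula n Φ Θ) (ω : MeasurableSpace.Carrier Ω) →
                    ω ∈ set (M ⟦ φ ⟧) →
                    (d̂₀ ω , d̂ ω) ∈ set (ℐ isTypeSpace E₀∈𝓢 ⟦ φ ⟧ᴵ))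
proposition7 em Θ M = 𝒯-isTypeSpace em Θ M , E₀-measurable em Θ M ∘ atom
  -- `embed-[]` places `φ` in the description of the image of `ω`.
  , λ φ ω true → proj₂ (truth-sets em Θ M φ) (proj₂ (Construction.embed-[] em Θ M φ) true)
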